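{- Let $\tau$ be a relational vocabulary and let $\varphi(z_1,\ldots,z_n)$ be a $\forall\mathcal{D}(\tau)$-formula of the form $\forall y_1\cdots\forall y_l\,\beta$ with $\beta$ a quantifier-free dependence logic formula over $\tau$. The following statements are equivalent: 1. $\varphi$ is strongly coherent. 2. $\varphi$ is rewritable to a universal first-order sentence. 3. $\varphi$ is first-order rewritable.
   Context: Syntax. For a relational vocabulary $\tau$, $\forall\mathcal{D}(\tau)$ (universal dependence logic) is the set of formulas built from literals $R(\vec x)$, $\neg R(\vec x)$, $x=y$, $\neg x=y$ ($R\in\tau$, variables $x,y,\vec x$) and dependence atoms $\mathrm{dep}(y_1,\ldots,y_m,z)$ ($m\ge 0$, distinct variables) using $\wedge$, $\vee$ and $\forall x$ (no $\exists$). Quantifier-free dependence logic formulas over $\tau$ ($\mathcal{D}\mathrm{QF}(\tau)$) are those without quantifiers. $\varphi(z_1,\dots,z_n)$ indicates that the free variables of $\varphi$ are among $z_1,\dots,z_n$. Teams. Structures have nonempty universes; $A$ is the universe of $\mathcal{A}$. A team with domain $V$ (a set of variables) and range $A$ is a set $T$ of assignments $s:V\to A$; a subteam is a subset. For a variable $x$, $T^x_A=\{s^x_a : s\in T, a\in A\}$, where $s^x_a$ has domain $V\cup\{x\}$, maps $x$ to $a$ and agrees with $s$ on the other variables; for $\vec y=y_1,\dots,y_l$, $T^{\vec y}_A$ is the result of doing this successively for $y_1,\dots,y_l$. For domain $\{z_1,\dots,z_n\}$, $\mathrm{Rel}(T)=\{(s(z_1),\dots,s(z_n)) : s\in T\}\subseteq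 A^n$. Semantics. $\mathcal{A}\models_T\varphi$ is defined for teams whose domain contains the free variables: for a literal $\ell$, $\mathcal{A}\models_T \ell$ iff every $s\in T$ satisfies $\ell$ in $\mathcal{A}$ in the usual sense; $\mathcal{A}\models_T\mathrm{dep}(\vec y,z)$ iff for all $s_1,s_2\in T$, $s_1(y_j)=s_2(y_j)$ for all $j$ implies $s_1(z)=s_2(z)$; $\mathcal{A}\models_T\varphi_1\wedge\varphi_2$ iff both hold; $\mathcal{A}\models_T\varphi_1\vee\varphi_2$ iff there are $T_1,T_2$ with $T=T_1\cup T_2$, $\mathcal{A}\models_{T_1}\varphi_1$ and $\mathcal{A}\models_{T_2}\varphi_2$; $\mathcal{A}\models_T\forall x\psi$ iff $\mathcal{A}\models_{T^x_A}\psi$. Rewritability. $\varphi(z_1,\dots,z_n)$ is first-order rewritable (resp. rewritable to a universal first-order sentence) if there is a first-order sentence (resp. a first-order sentence $\forall \vec u\,\theta$ with $\theta$ quantifier-free) $\varphi^*$ over $\tau\cup\{R\}$, with $R$ a new $n$-ary relation symbol, such that for every (finite or infinite) $\tau$-structure $\mathcal{A}$ and every team $T$ with domain $\{z_1,\dots,z_n\}$ and range $A$: $\mathcal{A}\models_T\varphi$ iff $(\mathcal{A},\mathrm{Rel}(T))\models\varphi^*$. Strong coherence. $\varphi=\forall\vec y\,\beta$ with $\beta\in\mathcal{D}\mathrm{QF}(\tau)$ is strongly $k$-coherent if for every (finite or infinite) $\tau$-structure $\mathcal{A}$ and every team $T$ with domain $\{z_1,\dots,z_n\}$ and range $A$: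 $\mathcal{A}\models_T\varphi$ iff $\mathcal{A}\models_S\beta$ for all subteams $S\subseteq T^{\vec y}_A$ with at most $k$ elements. It is strongly coherent if it is strongly $k$-coherent for some $k\ge1$. -}

module Defs where

open import Data.Fin using (Fin)
open import Data.List using (List; length)
import Data.List.Membership.Propositional as List
open import Data.Maybe using (Maybe; just; nothing)
open import Data.Nat using (ℕ; suc; _≤_)
open import Data.Product using (Σ; ∃; _×_)
open import Data.Sum using (_⊎_)
open import Data.Vec using (Vec; []; _∷_; lookup; map; _[_]≔_)
open import Data.Vec.Relation.Unary.Unique.Propositional using (Unique)
open import Function.Bundles using (_⇔_)
open import Level using (0ℓ; Lift)
open import Relation.Binary.Construct.Closure.ReflexiveTransitive using (Star; ε; _◅_)
open import Relation.Binary.PropositionalEquality using (_≡_)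
open import Relation.Nullary using (¬_)
open import Relation.Unary using (Pred; _∈_; _⊆_; _∪_; _≐_)

record Vocabulary : Set₁ where
  field
    Sym   : Set
    arity : Sym → ℕ

open Vocabulary public

record Structure (τ : Vocabulary) : Set₁ where
  field
    Carrier  : Set
    nonempty : Carrier
    rel      : (R : Sym τ) → Pred (Vec Carrier (arity τ R)) 0ℓ

open Structure public

-- τ ∪ {R} with R a new n-ary symbol; R is `nothing`.
_∪[_] : Vocabulary → ℕ → Vocabulary
Sym   (τ ∪[ n ])          = Maybe (Sym τ)
arity (τ ∪[ n ]) (just P) = arity τ P
arity (τ ∪[ n ]) nothing  = n

expand : ∀ {τ n} (𝒜 : Structure τ) → Pred (Vec (Carrier 𝒜) n) 0ℓ → Structure (τ ∪[ n ])
Carrier  (expand 𝒜 X)          = Carrier 𝒜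
nonempty (expand 𝒜 X)          = nonempty 𝒜
rel      (expand 𝒜 X) (just P) = rel 𝒜 P
rel      (expand 𝒜 X) nothing  = X

-- Formulas are intrinsically scoped: a domain of n distinct variables is
-- Fin n, and an assignment on it is a vector of values.  Teams are sets of
-- assignments, compared extensionally by _≐_.

Assignment : Set → ℕ → Set
Assignment A n = Vec A n

Team : Set → ℕ → Set₁
Team A n = Pred (Assignment A n) 0ℓ

-- n ▷ m is a variable x together with the passage from a domain V of size n
-- to V ∪ {x} of size m: either x ∉ V, and x becomes variable 0 of the larger
-- domain, or x is already in V, and requantifying it overwrites its value.
data _▷_ : ℕ → ℕ → Set where
  fresh : ∀ {n} → n ▷ suc n
  reuse : ∀ {n} → Fin n → n ▷ n

_[_↦_] : ∀ {A n m} → Assignment A n → n ▷ m → A → Assignment A m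
s [ fresh   ↦ a ] = a ∷ s
s [ reuse i ↦ a ] = s [ i ]≔ a

_⟨_⟩ : ∀ {A n m} → Team A n → n ▷ m → Team A m
(T ⟨ x ⟩) t = ∃ λ s → ∃ λ a → s ∈ T × t ≡ s [ x ↦ a ]

-- A sequence y₁,…,y_l of variables, leading from a domain of size n to one of
-- size m.  Its length l is not part of the type: it may differ from m ∸ n,
-- since variables may be repeated or lie in the original domain.
_▷*_ : ℕ → ℕ → Set
_▷*_ = Star _▷_

_⟨_⟩* : ∀ {A n m} → Team A n → n ▷* m → Team A m
T ⟨ ε ⟩*      = T
T ⟨ y ◅ ys ⟩* = (T ⟨ y ⟩) ⟨ ys ⟩*

data Literal (τ : Vocabulary) (n : ℕ) : Set where
  pos : (R : Sym τ) → Vec (Fin n) (arity τ R) → Literal τ n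
  neg : (R : Sym τ) → Vec (Fin n) (arity τ R) → Literal τ n
  eq  : Fin n → Fin n → Literal τ n
  neq : Fin n → Fin n → Literal τ n

SatLiteral : ∀ {τ n} (𝒜 : Structure τ) → Assignment (Carrier 𝒜) n → Literal τ n → Set
SatLiteral 𝒜 s (pos R xs) = map (lookup s) xs ∈ rel 𝒜 R
SatLiteral 𝒜 s (neg R xs) = ¬ (map (lookup s) xs ∈ rel 𝒜 R)
SatLiteral 𝒜 s (eq x y)   = lookup s x ≡ lookup s y
SatLiteral 𝒜 s (neq x y)  = ¬ (lookup s x ≡ lookup s y)

infixr 6 _∧_
infixr 5 _∨_

-- Universal dependence logic: formulas with free variables among n variables.
data ∀𝒟 (τ : Vocabulary) : ℕ → Set where
  lit : ∀ {n} → Literal τ n → ∀𝒟 τ n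
  dep : ∀ {n k} (ys : Vec (Fin n) k) (z : Fin n) → Unique (z ∷ ys) → ∀𝒟 τ n
  _∧_ : ∀ {n} → ∀𝒟 τ n → ∀𝒟 τ n → ∀𝒟 τ n
  _∨_ : ∀ {n} → ∀𝒟 τ n → ∀𝒟 τ n → ∀𝒟 τ n
  all : ∀ {n m} → n ▷ m → ∀𝒟 τ m → ∀𝒟 τ n

data QuantifierFree {τ : Vocabulary} {n : ℕ} : ∀𝒟 τ n → Set where
  lit : ∀ l → QuantifierFree (lit l)
  dep : ∀ {k} (ys : Vec (Fin n) k) z u → QuantifierFree (dep ys z u)
  _∧_ : ∀ {φ ψ} → QuantifierFree φ → QuantifierFree ψ → QuantifierFree (φ ∧ ψ)
  _∨_ : ∀ {φ ψ} → QuantifierFree φ → QuantifierFree ψ → QuantifierFree (φ ∨ ψ)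

all* : ∀ {τ n m} → n ▷* m → ∀𝒟 τ m → ∀𝒟 τ n
all* ε        β = β
all* (y ◅ ys) β = all y (all* ys β)

infix 4 _⊨[_]_ _⊨_

_⊨[_]_ : ∀ {τ n} (𝒜 : Structure τ) → Team (Carrier 𝒜) n → ∀𝒟 τ n → Set₁
𝒜 ⊨[ T ] lit l      = Lift _ (∀ {s} → s ∈ T → SatLiteral 𝒜 s l)
𝒜 ⊨[ T ] dep ys z _ = Lift _ (∀ {s₁ s₂} → s₁ ∈ T → s₂ ∈ T →
                        (∀ j → lookup s₁ (lookup ys j) ≡ lookup s₂ (lookup ys j)) →
                        lookup s₁ z ≡ lookup s₂ z)
𝒜 ⊨[ T ] (φ ∧ ψ)    = 𝒜 ⊨[ T ] φ × 𝒜 ⊨[ T ] ψ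
𝒜 ⊨[ T ] (φ ∨ ψ)    = ∃ λ T₁ → ∃ λ T₂ → T ≐ (T₁ ∪ T₂) × 𝒜 ⊨[ T₁ ] φ × 𝒜 ⊨[ T₂ ] ψ
𝒜 ⊨[ T ] all x ψ    = 𝒜 ⊨[ T ⟨ x ⟩ ] ψ

data FO (τ : Vocabulary) : ℕ → Set where
  atom : ∀ {n} (R : Sym τ) → Vec (Fin n) (arity τ R) → FO τ n
  eq   : ∀ {n} → Fin n → Fin n → FO τ n
  not  : ∀ {n} → FO τ n → FO τ n
  _∧_  : ∀ {n} → FO τ n → FO τ n → FO τ n
  _∨_  : ∀ {n} → FO τ n → FO τ n → FO τ n
  all  : ∀ {n} → FO τ (suc n) → FO τ n
  ex   : ∀ {n} → FO τ (suc n) → FO τ n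

Sentence : Vocabulary → Set
Sentence τ = FO τ 0

data QuantifierFreeFO {τ : Vocabulary} {n : ℕ} : FO τ n → Set where
  atom : ∀ R xs → QuantifierFreeFO (atom R xs)
  eq   : ∀ x y → QuantifierFreeFO (eq x y)
  not  : ∀ {θ} → QuantifierFreeFO θ → QuantifierFreeFO (not θ)
  _∧_  : ∀ {θ η} → QuantifierFreeFO θ → QuantifierFreeFO η → QuantifierFreeFO (θ ∧ η)
  _∨_  : ∀ {θ η} → QuantifierFreeFO θ → QuantifierFreeFO η → QuantifierFreeFO (θ ∨ η)

data Universal {τ : Vocabulary} : ∀ {n} → FO τ n → Set where
  matrix : ∀ {n} {θ : FO τ n} → QuantifierFreeFO θ → Universal θ
  all    : ∀ {n} {χ : FO τ (suc n)} → Universal χ → Universal (all χ)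

SatFO : ∀ {τ n} (𝒜 : Structure τ) → Assignment (Carrier 𝒜) n → FO τ n → Set
SatFO 𝒜 s (atom R xs) = map (lookup s) xs ∈ rel 𝒜 R
SatFO 𝒜 s (eq x y)    = lookup s x ≡ lookup s y
SatFO 𝒜 s (not χ)     = ¬ SatFO 𝒜 s χ
SatFO 𝒜 s (χ ∧ ξ)     = SatFO 𝒜 s χ × SatFO 𝒜 s ξ
SatFO 𝒜 s (χ ∨ ξ)     = SatFO 𝒜 s χ ⊎ SatFO 𝒜 s ξ
SatFO 𝒜 s (all χ)     = ∀ a → SatFO 𝒜 (a ∷ s) χ
SatFO 𝒜 s (ex χ)      = ∃ λ a → SatFO 𝒜 (a ∷ s) χ

_⊨_ : ∀ {τ} → Structure τ → Sentence τ → Set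
𝒜 ⊨ χ = SatFO 𝒜 [] χ

-- With z₁,…,zₙ listed in the order of Fin n, the tuple (s(z₁),…,s(zₙ)) is the
-- vector s itself.
Rel : ∀ {A n} → Team A n → Pred (Vec A n) 0ℓ
Rel T = T

_Rewrites_ : ∀ {τ n} → Sentence (τ ∪[ n ]) → ∀𝒟 τ n → Set₁
_Rewrites_ {τ} {n} φ* φ =
  (𝒜 : Structure τ) (T : Team (Carrier 𝒜) n) → 𝒜 ⊨[ T ] φ ⇔ expand 𝒜 (Rel T) ⊨ φ*

FORewritable : ∀ {τ n} → ∀𝒟 τ n → Set₁
FORewritable φ = ∃ λ φ* → φ* Rewrites φ

UniversallyRewritable : ∀ {τ n} → ∀𝒟 τ n → Set₁
UniversallyRewritable φ = ∃ λ φ* → Universal φ* × φ* Rewrites φ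

AtMost : ∀ {A : Set} → ℕ → Pred A 0ℓ → Set
AtMost {A} k S = Σ (List A) λ xs → length xs ≤ k × S ⊆ (List._∈ xs)

-- Strong coherence of ∀y₁…∀y_l β, as a property of the pair (y₁…y_l , β).
StronglyCoherentWith : ∀ {τ n m} → ℕ → n ▷* m → ∀𝒟 τ m → Set₁
StronglyCoherentWith {τ} {n} k ys β =
  (𝒜 : Structure τ) (T : Team (Carrier 𝒜) n) →
  𝒜 ⊨[ T ] all* ys β ⇔ (∀ S → S ⊆ (T ⟨ ys ⟩*) → AtMost k S → 𝒜 ⊨[ S ] β)

StronglyCoherent : ∀ {τ n m} → n ▷* m → ∀𝒟 τ m → Set₁
StronglyCoherent ys β = ∃ λ k → 1 ≤ k × StronglyCoherentWith k ys β

{-# OPTIONS --safe #-}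
module Submission where

-- A bound k on the size of the subteams to be tested turns into a universal
-- sentence: "any k assignments in T^ys satisfy β", where satisfaction of β by a
-- team of k named assignments is a quantifier-free condition.
--
-- Conversely, let χ rewrite ∀ys β and suppose that for each k there are 𝒜 k, T k
-- such that the subteams of (T k)^ys of size ≤ k + 1 satisfy β while T k fails
-- ∀ys β.  Countably many sequences in ∏ 𝒜 k, closed under witnesses for χ, modulo
-- a filter on ℕ form a countable limit structure in which Łoś's theorem holds for
-- χ, so that χ fails there.  Only countably many sets of indices need to be
-- decided, so a descending chain of infinite sets replaces an ultrafilter.  If the
-- filter also decides the teams that split the disjunctions of β on growing
-- finite subteams, these splittings converge and β holds of the whole limit team:
-- a contradiction.

open import Defs
open import Axiom.ExcludedMiddle using (ExcludedMiddle)
open import Data.Fin using (Fin; zero; suc; combine; remQuot; _↑ˡ_; _↑ʳ_)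
open import Data.Fin.Properties using (remQuot-combine)
open import Data.List using (List; []; _∷_; length; allFin; upTo)
import Data.List as List
open import Data.List.Membership.Propositional using () renaming (_∈_ to _∈ˡ_)
open import Data.List.Membership.Propositional.Properties using (∈-allFin; ∈-map⁺; ∈-upTo⁺; ∈-tabulate⁺; ∈-tabulate⁻)
open import Data.List.Properties using (length-map; length-tabulate; length-upTo)
open import Data.List.Relation.Unary.All using (All; []; _∷_)
import Data.List.Relation.Unary.All as All
import Data.List.Relation.Unary.All.Properties as All
open import Data.List.Relation.Unary.Any using (here; there)
open import Data.Maybe using (just; nothing)
open import Data.Nat using (ℕ; zero; suc; _+_; _*_; _⊔_; _≤_; _<_; z≤n; s≤s; _≤′_; ≤′-reflexive; ≤′-step; _≤?_)
open import Data.Nat.Induction using (<-rec)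
open import Data.Nat.Properties using (+-suc; +-identityʳ; suc-injective; ≡-irrelevant; ≤-refl; ≤-reflexive; ≤-trans; ≤-antisym; ≤⇒≤′; ≰⇒>; ≮⇒≥; n≮n; n≤1+n; m≤m+n; m≤n+m; m≤m⊔n; m≤n⊔m)
open import Data.Product using (∃; ∃₂; _×_; _,_; proj₁; proj₂; uncurry)
open import Data.Sum using (_⊎_; inj₁; inj₂; [_,_]′)
import Data.Sum as Sum
open import Data.Unit using (⊤; tt)
open import Data.Vec.Relation.Unary.All using ([]; _∷_)
import Data.Vec.Relation.Unary.All as VecAll
open import Data.Vec using (Vec; []; _∷_; lookup; map; tabulate; _++_)
open import Data.Vec.Properties using (lookup-map; map-∘; map-cong; map-[]≔; lookup-++ˡ; lookup-++ʳ; lookup∘tabulate; tabulate∘lookup; tabulate-∘; tabulate-cong)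
open import Function using (_∘_; id)
open import Function.Bundles using (_⇔_; mk⇔; Equivalence)
open import Function.Construct.Composition using (_⇔-∘_)
open import Level using (0ℓ; Lift; lift; lower) renaming (suc to lsuc)
open import Relation.Binary.Construct.Closure.ReflexiveTransitive using (ε; _◅_)
open import Relation.Binary.PropositionalEquality using (_≡_; refl; sym; trans; cong; cong₂; subst; subst₂)
open import Relation.Nullary using (¬_; yes; no; contradiction)
open import Relation.Nullary.Decidable using (map′; decidable-stable)
open import Relation.Unary using (Pred; _∈_; _⊆_; _∪_; _∩_; _≐_; ∁)

open Equivalence using (to; from)

private variable
  X Y : Set
  k l m n N : ℕ
  τ : Vocabulary

-- Assignments, quantifier prefixes and basic facts of team semantics

map-lookup-map : (f : X → Y) (u : Vec X m) (xs : Vec (Fin m) k) →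
                 map (lookup (map f u)) xs ≡ map f (map (lookup u) xs)
map-lookup-map f u xs = trans (map-cong (λ i → lookup-map i f u) xs) (map-∘ f (lookup u) xs)

steps : n ▷* m → ℕ
steps ε        = 0
steps (_ ◅ ys) = suc (steps ys)

_[_↦*_] : Vec X n → (ys : n ▷* m) → Vec X (steps ys) → Vec X m
s [ ε      ↦* []     ] = s
s [ y ◅ ys ↦* a ∷ as ] = (s [ y ↦ a ]) [ ys ↦* as ]

map-↦ : (f : X → Y) (s : Vec X n) (y : n ▷ m) (a : X) → map f (s [ y ↦ a ]) ≡ map f s [ y ↦ f a ]
map-↦ f s fresh     a = refl
map-↦ f s (reuse i) a = map-[]≔ f s i

map-↦* : (f : X → Y) (s : Vec X n) (ys : n ▷* m) (as : Vec X (steps ys)) →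
         map f (s [ ys ↦* as ]) ≡ map f s [ ys ↦* map f as ]
map-↦* f s ε        []       = refl
map-↦* f s (y ◅ ys) (a ∷ as) =
  trans (map-↦* f (s [ y ↦ a ]) ys as) (cong _[ ys ↦* map f as ] (map-↦ f s y a))

∈-⟨⟩*⁺ : (ys : n ▷* m) {T : Team X n} {s : Vec X n} (as : Vec X (steps ys)) →
         s ∈ T → s [ ys ↦* as ] ∈ T ⟨ ys ⟩*
∈-⟨⟩*⁺ ε        []       s∈T = s∈T
∈-⟨⟩*⁺ (y ◅ ys) (a ∷ as) s∈T = ∈-⟨⟩*⁺ ys as (_ , a , s∈T , refl)

∈-⟨⟩*⁻ : (ys : n ▷* m) {T : Team X n} {t : Vec X m} → t ∈ T ⟨ ys ⟩* →
         ∃₂ λ s as → s ∈ T × t ≡ s [ ys ↦* as ]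
∈-⟨⟩*⁻ ε        t∈ = _ , [] , t∈ , refl
∈-⟨⟩*⁻ (y ◅ ys) t∈ with ∈-⟨⟩*⁻ ys t∈
... | _ , as , (s , a , s∈T , refl) , refl = s , a ∷ as , s∈T , refl

⊨-all* : (𝒜 : Structure τ) (ys : n ▷* m) {T : Team (Carrier 𝒜) n} {β : ∀𝒟 τ m} →
         (𝒜 ⊨[ T ] all* ys β) ≡ (𝒜 ⊨[ T ⟨ ys ⟩* ] β)
⊨-all* 𝒜 ε        = refl
⊨-all* 𝒜 (y ◅ ys) = ⊨-all* 𝒜 ys

downward-closed : {β : ∀𝒟 τ m} → QuantifierFree β → (𝒜 : Structure τ) {S T : Team (Carrier 𝒜) m} →
                  S ⊆ T → 𝒜 ⊨[ T ] β → 𝒜 ⊨[ S ] β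
downward-closed (lit _)     𝒜 S⊆T (lift h) = lift (h ∘ S⊆T)
downward-closed (dep _ _ _) 𝒜 S⊆T (lift h) = lift λ s t → h (S⊆T s) (S⊆T t)
downward-closed (p ∧ q)     𝒜 S⊆T (h , h′) = downward-closed p 𝒜 S⊆T h , downward-closed q 𝒜 S⊆T h′
downward-closed (p ∨ q)     𝒜 {S} S⊆T (T₁ , T₂ , (T⊆ , _) , h₁ , h₂) =
  S ∩ T₁ , S ∩ T₂ ,
  ((λ s → Sum.map (s ,_) (s ,_) (T⊆ (S⊆T s))) , [ proj₁ , proj₁ ]′) ,
  downward-closed p 𝒜 proj₂ h₁ , downward-closed q 𝒜 proj₂ h₂

-- Needed because an empty subteam has no element with which to pad an enumeration by `Fin k`.
⊨-∅ : {β : ∀𝒟 τ m} → QuantifierFree β → (𝒜 : Structure τ) {S : Team (Carrier 𝒜) m} →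
      ¬ ∃ S → 𝒜 ⊨[ S ] β
⊨-∅ (lit _)     𝒜 S≡∅ = lift λ s → contradiction (_ , s) S≡∅
⊨-∅ (dep _ _ _) 𝒜 S≡∅ = lift λ s _ → contradiction (_ , s) S≡∅
⊨-∅ (p ∧ q)     𝒜 S≡∅ = ⊨-∅ p 𝒜 S≡∅ , ⊨-∅ q 𝒜 S≡∅
⊨-∅ (p ∨ q)     𝒜 {S} S≡∅ = S , S , (inj₁ , [ id , id ]′) , ⊨-∅ p 𝒜 S≡∅ , ⊨-∅ q 𝒜 S≡∅

Bounded : ℕ → (ys : n ▷* m) → ∀𝒟 τ m → (𝒜 : Structure τ) → Team (Carrier 𝒜) n → Set₁
Bounded k ys β 𝒜 T = ∀ S → S ⊆ (T ⟨ ys ⟩*) → AtMost k S → 𝒜 ⊨[ S ] β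

excluded-middle₀ : ExcludedMiddle (lsuc 0ℓ) → ExcludedMiddle 0ℓ
excluded-middle₀ em {P} = map′ lower lift (em {Lift _ P})

-- Finite teams of tuples of variables

-- The extra variable only serves to make a tautology available.
true : FO τ (suc N)
true = eq zero zero

⋀ : (X → FO τ (suc N)) → List X → FO τ (suc N)
⋀ θ []       = true
⋀ θ (x ∷ xs) = θ x ∧ ⋀ θ xs

⋀-quantifierFree : {θ : X → FO τ (suc N)} → (∀ x → QuantifierFreeFO (θ x)) →
                   ∀ xs → QuantifierFreeFO (⋀ θ xs)
⋀-quantifierFree h []       = eq zero zero
⋀-quantifierFree h (x ∷ xs) = h x ∧ ⋀-quantifierFree h xs

⋀-sat : (𝒜 : Structure τ) {e : Vec (Carrier 𝒜) (suc N)} {θ : X → FO τ (suc N)} (xs : List X) →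
        SatFO 𝒜 e (⋀ θ xs) ⇔ All (SatFO 𝒜 e ∘ θ) xs
⋀-sat 𝒜 []       = mk⇔ (λ _ → []) (λ _ → refl)
⋀-sat 𝒜 (x ∷ xs) = mk⇔ (λ (h , hs) → h ∷ to (⋀-sat 𝒜 xs) hs) λ where
  (h ∷ hs) → h , from (⋀-sat 𝒜 xs) hs

-- The last two arguments accumulate the two parts of the list.
splittings : (F G : List X → FO τ N) → (xs xs₁ xs₂ : List X) → FO τ N
splittings F G []       xs₁ xs₂ = F xs₁ ∧ G xs₂
splittings F G (x ∷ xs) xs₁ xs₂ = splittings F G xs (x ∷ xs₁) xs₂ ∨ splittings F G xs xs₁ (x ∷ xs₂)

module _ {F G : List X → FO τ N} where

  splittings-quantifierFree :
    (∀ xs → QuantifierFreeFO (F xs)) → (∀ xs → QuantifierFreeFO (G xs)) →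
    ∀ xs xs₁ xs₂ → QuantifierFreeFO (splittings F G xs xs₁ xs₂)
  splittings-quantifierFree f g []       xs₁ xs₂ = f xs₁ ∧ g xs₂
  splittings-quantifierFree f g (x ∷ xs) xs₁ xs₂ =
    splittings-quantifierFree f g xs (x ∷ xs₁) xs₂ ∨ splittings-quantifierFree f g xs xs₁ (x ∷ xs₂)

  module _ (𝒜 : Structure τ) {e : Vec (Carrier 𝒜) N} where

    -- The inclusions of the accumulators strengthen the induction: they carry an entry, once placed
    -- on one side, through the remaining choices to the final list of that side.
    splittings-sound : ∀ xs {xs₁ xs₂} → SatFO 𝒜 e (splittings F G xs xs₁ xs₂) →
      ∃₂ λ zs₁ zs₂ → SatFO 𝒜 e (F zs₁) × SatFO 𝒜 e (G zs₂) ×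
        (∀ {x} → x ∈ˡ xs → x ∈ˡ zs₁ ⊎ x ∈ˡ zs₂) ×
        (∀ {x} → x ∈ˡ xs₁ → x ∈ˡ zs₁) × (∀ {x} → x ∈ˡ xs₂ → x ∈ˡ zs₂)
    splittings-sound [] (f , g) = _ , _ , f , g , (λ ()) , id , id
    splittings-sound (x ∷ xs) (inj₁ h) with splittings-sound xs h
    ... | _ , _ , f , g , cover , sub₁ , sub₂ =
      _ , _ , f , g , (λ { (here refl) → inj₁ (sub₁ (here refl)) ; (there x∈) → cover x∈ }) ,
      sub₁ ∘ there , sub₂
    splittings-sound (x ∷ xs) (inj₂ h) with splittings-sound xs h
    ... | _ , _ , f , g , cover , sub₁ , sub₂ =
      _ , _ , f , g , (λ { (here refl) → inj₂ (sub₂ (here refl)) ; (there x∈) → cover x∈ }) ,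
      sub₁ , sub₂ ∘ there

    splittings-complete : {P Q : Pred X 0ℓ} →
      (∀ {xs} → All P xs → SatFO 𝒜 e (F xs)) → (∀ {xs} → All Q xs → SatFO 𝒜 e (G xs)) →
      ∀ {xs xs₁ xs₂} → All (P ∪ Q) xs → All P xs₁ → All Q xs₂ →
      SatFO 𝒜 e (splittings F G xs xs₁ xs₂)
    splittings-complete f g []            ps qs = f ps , g qs
    splittings-complete f g (inj₁ p ∷ hs) ps qs = inj₁ (splittings-complete f g hs (p ∷ ps) qs)
    splittings-complete f g (inj₂ q ∷ hs) ps qs = inj₂ (splittings-complete f g hs ps (q ∷ qs))

literalFormula : Literal τ m → Vec (Fin N) m → FO (τ ∪[ n ]) N
literalFormula (pos R xs) u = atom (just R) (map (lookup u) xs)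
literalFormula (neg R xs) u = not (atom (just R) (map (lookup u) xs))
literalFormula (eq x y)   u = eq (lookup u x) (lookup u y)
literalFormula (neq x y)  u = not (eq (lookup u x) (lookup u y))

agreement : Vec (Fin m) k → (u v : Vec (Fin (suc N)) m) → FO (τ ∪[ n ]) (suc N)
agreement {k = k} ys u v = ⋀ (λ j → eq (lookup u (lookup ys j)) (lookup v (lookup ys j))) (allFin k)

-- On finitely many named tuples, the second-order choice of a splitting becomes a finite
-- disjunction over all ways to distribute the list.
teamFormula : {β : ∀𝒟 τ m} → QuantifierFree β → List (Vec (Fin (suc N)) m) → FO (τ ∪[ n ]) (suc N)
teamFormula (lit l)      us = ⋀ (literalFormula l) us
teamFormula (dep ys z _) us =
  ⋀ (λ u → ⋀ (λ v → not (agreement ys u v) ∨ eq (lookup u z) (lookup v z)) us) us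
teamFormula (p ∧ q)      us = teamFormula p us ∧ teamFormula q us
teamFormula (p ∨ q)      us = splittings (teamFormula p) (teamFormula q) us [] []

literalFormula-quantifierFree : (l : Literal τ m) (u : Vec (Fin N) m) →
                                QuantifierFreeFO (literalFormula {n = n} l u)
literalFormula-quantifierFree (pos R xs) u = atom _ _
literalFormula-quantifierFree (neg R xs) u = not (atom _ _)
literalFormula-quantifierFree (eq x y)   u = eq _ _
literalFormula-quantifierFree (neq x y)  u = not (eq _ _)

teamFormula-quantifierFree : {β : ∀𝒟 τ m} (q : QuantifierFree β) (us : List (Vec (Fin (suc N)) m)) →
                             QuantifierFreeFO (teamFormula {n = n} q us)
teamFormula-quantifierFree (lit l)      us = ⋀-quantifierFree (literalFormula-quantifierFree l) us
teamFormula-quantifierFree (dep ys z _) us =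
  ⋀-quantifierFree (λ _ → ⋀-quantifierFree (λ _ → not (⋀-quantifierFree (λ _ → eq _ _) _) ∨ eq _ _) us) us
teamFormula-quantifierFree (p ∧ q)      us = teamFormula-quantifierFree p us ∧ teamFormula-quantifierFree q us
teamFormula-quantifierFree (p ∨ q)      us =
  splittings-quantifierFree (teamFormula-quantifierFree p) (teamFormula-quantifierFree q) us [] []

module _ (𝒜 : Structure τ) {T : Team (Carrier 𝒜) n} (e : Vec (Carrier 𝒜) (suc N)) where

  private
    value : Vec (Fin (suc N)) m → Vec (Carrier 𝒜) m
    value = map (lookup e)

  value-≡ : (u v : Vec (Fin (suc N)) m) (x y : Fin m) →
            (lookup e (lookup u x) ≡ lookup e (lookup v y)) ⇔ (lookup (value u) x ≡ lookup (value v) y)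
  value-≡ u v x y rewrite lookup-map x (lookup e) u | lookup-map y (lookup e) v = mk⇔ id id

  literalFormula-sat : (l : Literal τ m) (u : Vec (Fin (suc N)) m) →
                       SatFO (expand 𝒜 T) e (literalFormula l u) ⇔ SatLiteral 𝒜 (value u) l
  literalFormula-sat (pos R xs) u =
    mk⇔ (subst (rel 𝒜 R) (sym (map-lookup-map (lookup e) u xs)))
        (subst (rel 𝒜 R) (map-lookup-map (lookup e) u xs))
  literalFormula-sat (neg R xs) u =
    mk⇔ (_∘ subst (rel 𝒜 R) (map-lookup-map (lookup e) u xs))
        (_∘ subst (rel 𝒜 R) (sym (map-lookup-map (lookup e) u xs)))
  literalFormula-sat (eq x y)  u = value-≡ u u x y
  literalFormula-sat (neq x y) u = mk⇔ (_∘ from (value-≡ u u x y)) (_∘ to (value-≡ u u x y))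

  agreement-sat : (ys : Vec (Fin m) k) (u v : Vec (Fin (suc N)) m) →
    SatFO (expand 𝒜 T) e (agreement ys u v) ⇔
    (∀ j → lookup (value u) (lookup ys j) ≡ lookup (value v) (lookup ys j))
  agreement-sat {k = k} ys u v = mk⇔
    (λ h j → to (value-≡ u v (lookup ys j) (lookup ys j)) (All.lookup (to (⋀-sat _ _) h) (∈-allFin j)))
    (λ h → from (⋀-sat _ _) (All.tabulate {xs = allFin k} λ {j} _ → from (value-≡ u v (lookup ys j) (lookup ys j)) (h j)))

  -- Asking only that the values cover `S`, not that they form `S`, lets the induction pass to the
  -- two parts of a splitting.
  teamFormula-sound : {β : ∀𝒟 τ m} (q : QuantifierFree β) (us : List (Vec (Fin (suc N)) m)) →
    SatFO (expand 𝒜 T) e (teamFormula q us) →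
    {S : Team (Carrier 𝒜) m} → (∀ {s} → s ∈ S → ∃ λ u → u ∈ˡ us × s ≡ value u) → 𝒜 ⊨[ S ] β
  teamFormula-sound (lit l) us h cover = lift λ s∈S → case-cover (cover s∈S)
    where
    case-cover : ∀ {s} → (∃ λ u → u ∈ˡ us × s ≡ value u) → SatLiteral 𝒜 s l
    case-cover (u , u∈ , refl) = to (literalFormula-sat l u) (All.lookup (to (⋀-sat _ us) h) u∈)
  teamFormula-sound (dep ys z _) us h cover = lift λ s∈S t∈S → go (cover s∈S) (cover t∈S)
    where
    go : ∀ {s t} → (∃ λ u → u ∈ˡ us × s ≡ value u) → (∃ λ v → v ∈ˡ us × t ≡ value v) →
         (∀ j → lookup s (lookup ys j) ≡ lookup t (lookup ys j)) → lookup s z ≡ lookup t z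
    go (u , u∈ , refl) (v , v∈ , refl) agree
      with All.lookup (to (⋀-sat _ us) (All.lookup (to (⋀-sat _ us) h) u∈)) v∈
    ... | inj₁ ¬agree = contradiction (from (agreement-sat ys u v) agree) ¬agree
    ... | inj₂ uz≡vz  = to (value-≡ u v z z) uz≡vz
  teamFormula-sound (p ∧ q) us (h , h′) cover =
    teamFormula-sound p us h cover , teamFormula-sound q us h′ cover
  teamFormula-sound (p ∨ q) us h {S} cover with splittings-sound (expand 𝒜 T) us h
  ... | us₁ , us₂ , h₁ , h₂ , split , _ =
    -- The parts overlap when tuples from both lists have the same value; team disjunction allows
    -- this.
    S ∩ within us₁ , S ∩ within us₂ , ((λ s → decompose s (cover s)) , [ proj₁ , proj₁ ]′) ,
    teamFormula-sound p us₁ h₁ proj₂ , teamFormula-sound q us₂ h₂ proj₂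
    where
    within : List (Vec (Fin (suc N)) _) → Team (Carrier 𝒜) _
    within us s = ∃ λ u → u ∈ˡ us × s ≡ value u
    decompose : ∀ {s} → s ∈ S → s ∈ within us → s ∈ (S ∩ within us₁) ∪ (S ∩ within us₂)
    decompose s∈S (u , u∈ , s≡) =
      Sum.map (λ u∈₁ → s∈S , u , u∈₁ , s≡) (λ u∈₂ → s∈S , u , u∈₂ , s≡) (split u∈)

  -- The inclusion is opposite to that in `teamFormula-sound`. Excluded middle acts only at
  -- dependence atoms, whose implication is written with `not` and `∨`.
  teamFormula-complete : ExcludedMiddle 0ℓ → {β : ∀𝒟 τ m} (q : QuantifierFree β)
    {us : List (Vec (Fin (suc N)) m)} {S : Team (Carrier 𝒜) m} →
    𝒜 ⊨[ S ] β → All (λ u → value u ∈ S) us → SatFO (expand 𝒜 T) e (teamFormula q us)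
  teamFormula-complete em (lit l) {us} (lift h) us⊆S =
    from (⋀-sat _ us) (All.map (λ {u} u∈S → from (literalFormula-sat l u) (h u∈S)) us⊆S)
  teamFormula-complete em (dep ys z _) {us} {S} (lift h) us⊆S =
    from (⋀-sat _ us) (All.map (λ {u} u∈S → from (⋀-sat _ us) (All.map (λ {v} v∈S → pair u v u∈S v∈S) us⊆S)) us⊆S)
    where
    pair : ∀ u v → value u ∈ S → value v ∈ S →
      SatFO (expand 𝒜 T) e (not (agreement ys u v) ∨ eq (lookup u z) (lookup v z))
    pair u v u∈S v∈S with em {SatFO (expand 𝒜 T) e (agreement ys u v)}
    ... | no ¬agree = inj₁ ¬agree
    ... | yes agree = inj₂ (from (value-≡ u v z z) (h u∈S v∈S (to (agreement-sat ys u v) agree)))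
  teamFormula-complete em (p ∧ q) (h , h′) us⊆S =
    teamFormula-complete em p h us⊆S , teamFormula-complete em q h′ us⊆S
  teamFormula-complete em (p ∨ q) (S₁ , S₂ , (S⊆ , _) , h₁ , h₂) us⊆S =
    splittings-complete (expand 𝒜 T) (teamFormula-complete em p h₁) (teamFormula-complete em q h₂)
      (All.map S⊆ us⊆S) [] []

-- From strong coherence to a universal sentence

∀^ : ∀ N → FO τ N → Sentence τ
∀^ zero    χ = χ
∀^ (suc N) χ = ∀^ N (all χ)

∀^-universal : ∀ N {χ : FO τ N} → Universal χ → Universal (∀^ N χ)
∀^-universal zero    u = u
∀^-universal (suc N) u = ∀^-universal N (all u)

∀^-sat : (𝒜 : Structure τ) → ∀ N {χ : FO τ N} → 𝒜 ⊨ ∀^ N χ ⇔ (∀ e → SatFO 𝒜 e χ)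
∀^-sat 𝒜 zero    = mk⇔ (λ { h [] → h }) (λ h → h [])
∀^-sat 𝒜 (suc N) = mk⇔
  (λ { h (a ∷ e) → to (∀^-sat 𝒜 N) h e a })
  (λ h → from (∀^-sat 𝒜 N) λ e a → h (a ∷ e))

-- The variables are k blocks, each of which names s : Vec A n and the values
-- a : Vec A l given to the variables y₁,…,y_l, plus the extra variable 0.
module Blocks (k n l : ℕ) where

  width : ℕ
  width = k * (n + l)

  sVars : Fin k → Vec (Fin (suc width)) n
  sVars i = tabulate λ j → suc (combine i (j ↑ˡ l))

  aVars : Fin k → Vec (Fin (suc width)) l
  aVars i = tabulate λ j → suc (combine i (n ↑ʳ j))

  module _ (dummy : X) (s : Fin k → Vec X n) (a : Fin k → Vec X l) where

    fill : Vec X (suc width)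
    fill = dummy ∷ tabulate (uncurry (λ i → lookup (s i ++ a i)) ∘ remQuot (n + l))

    lookup-fill : ∀ i j → lookup fill (suc (combine i j)) ≡ lookup (s i ++ a i) j
    lookup-fill i j = trans (lookup∘tabulate _ (combine i j))
      (cong (uncurry λ i → lookup (s i ++ a i)) (remQuot-combine i j))

    fill-sVars : ∀ i → map (lookup fill) (sVars i) ≡ s i
    fill-sVars i = trans (sym (tabulate-∘ (lookup fill) _)) (trans
      (tabulate-cong λ j → trans (lookup-fill i (j ↑ˡ l)) (lookup-++ˡ (s i) (a i) j))
      (tabulate∘lookup (s i)))

    fill-aVars : ∀ i → map (lookup fill) (aVars i) ≡ a i
    fill-aVars i = trans (sym (tabulate-∘ (lookup fill) _)) (trans
      (tabulate-cong λ j → trans (lookup-fill i (n ↑ʳ j)) (lookup-++ʳ (s i) (a i) j))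
      (tabulate∘lookup (a i)))

-- `x₀` fills the indices beyond the end of the list.
enumerate : X → (xs : List X) → length xs ≤ k → ∃ λ (f : Fin k → X) → ∀ {x} → x ∈ˡ xs → ∃ λ i → f i ≡ x
enumerate x₀ []       _         = (λ _ → x₀) , λ ()
enumerate x₀ (x ∷ xs) (s≤s len) with enumerate x₀ xs len
... | f , covers = (λ { zero → x ; (suc i) → f i }) , λ where
  (here refl) → zero , refl
  (there x∈)  → let i , fi≡x = covers x∈ in suc i , fi≡x

module _ (em : ExcludedMiddle 0ℓ) where

  -- The list that bounds `S` may have entries outside `U`, so every entry outside `S` is redirected
  -- to a member of `S`. The sentence says something only when all `k` blocks name members of the
  -- team.
  enumerate-within : {S U : Pred X 0ℓ} → S ⊆ U → ∃ S → AtMost k S →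
                     ∃ λ (f : Fin k → X) → (∀ i → f i ∈ U) × (∀ {x} → x ∈ S → ∃ λ i → f i ≡ x)
  enumerate-within {X = X} {k = k} {S = S} {U} S⊆U (x₀ , x₀∈S) (xs , len , S⊆xs) =
    (λ i → proj₁ (redirect (f i))) , (λ i → proj₁ (proj₂ (redirect (f i)))) ,
    λ {x} x∈S → let i , fi≡x = covers (S⊆xs x∈S) in
      i , trans (proj₂ (proj₂ (redirect (f i))) (subst S (sym fi≡x) x∈S)) fi≡x
    where
    f      = proj₁ (enumerate {k = k} x₀ xs len)
    covers : ∀ {x} → x ∈ˡ xs → ∃ λ i → f i ≡ x
    covers = proj₂ (enumerate {k = k} x₀ xs len)
    redirect : (x : X) → ∃ λ x′ → x′ ∈ U × (x ∈ S → x′ ≡ x)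
    redirect x with em {x ∈ S}
    ... | yes x∈S = x , S⊆U x∈S , λ _ → refl
    ... | no  x∉S = x₀ , S⊆U x₀∈S , λ x∈S → contradiction x∈S x∉S

  module CoherenceSentence (k : ℕ) (ys : n ▷* m) {β : ∀𝒟 τ m} (q : QuantifierFree β) where

    open Blocks k n (steps ys)

    tuple : Fin k → Vec (Fin (suc width)) m
    tuple i = sVars i [ ys ↦* aVars i ]

    premise : FO (τ ∪[ n ]) (suc width)
    premise = ⋀ (λ i → atom nothing (sVars i)) (allFin k)

    body : FO (τ ∪[ n ]) (suc width)
    body = not premise ∨ teamFormula q (List.tabulate tuple)

    sentence : Sentence (τ ∪[ n ])
    sentence = ∀^ (suc width) body

    sentence-universal : Universal sentence
    sentence-universal = ∀^-universal (suc width) (matrix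
      (not (⋀-quantifierFree (λ _ → atom _ _) (allFin k)) ∨ teamFormula-quantifierFree q (List.tabulate tuple)))

    module _ (𝒜 : Structure τ) (T : Team (Carrier 𝒜) n) where

      sentence-sat : Bounded k ys β 𝒜 T ⇔ expand 𝒜 T ⊨ sentence
      sentence-sat = mk⇔ (λ h → from (∀^-sat _ (suc width)) (complete h)) (sound ∘ to (∀^-sat _ (suc width)))
        where
        complete : Bounded k ys β 𝒜 T → ∀ e → SatFO (expand 𝒜 T) e body
        complete h e with em {SatFO (expand 𝒜 T) e premise}
        ... | no ¬premise = inj₁ ¬premise
        ... | yes holds   = inj₂ (teamFormula-complete 𝒜 e em q
            -- The subteam tested consists of the values of the `k` tuples; coincidences only make
            -- it smaller.
            (h (_∈ˡ List.tabulate values) ⊆T⟨ys⟩ (_ , ≤-reflexive (length-tabulate values) , id))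
            (All.tabulate⁺ (∈-tabulate⁺ {f = values})))
          where
          values : Fin k → Vec (Carrier 𝒜) m
          values i = map (lookup e) (tuple i)
          ⊆T⟨ys⟩ : ∀ {t} → t ∈ˡ List.tabulate values → t ∈ T ⟨ ys ⟩*
          ⊆T⟨ys⟩ t∈ with ∈-tabulate⁻ t∈
          ... | i , refl = subst (_∈ T ⟨ ys ⟩*) (sym (map-↦* (lookup e) (sVars i) ys (aVars i)))
            (∈-⟨⟩*⁺ ys (map (lookup e) (aVars i)) (All.lookup (to (⋀-sat _ (allFin k)) holds) (∈-allFin i)))

        sound : (∀ e → SatFO (expand 𝒜 T) e body) → Bounded k ys β 𝒜 T
        sound h S S⊆ atMost with em {∃ S}
        ... | no S≡∅ = ⊨-∅ q 𝒜 S≡∅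
        ... | yes S≢∅ with enumerate-within S⊆ S≢∅ atMost
        ...   | f , f∈ , covers = conclude (h e)
          where
          pre : ∀ i → ∃₂ λ s as → s ∈ T × f i ≡ s [ ys ↦* as ]
          pre i = ∈-⟨⟩*⁻ ys (f∈ i)
          s = λ i → proj₁ (pre i)
          a = λ i → proj₁ (proj₂ (pre i))
          -- Block `i` receives an assignment in `T` and values for `ys` that together produce
          -- `f i`; the value of the extra variable is arbitrary.
          e = fill (nonempty 𝒜) s a
          values : ∀ i → map (lookup e) (tuple i) ≡ f i
          values i = trans (map-↦* (lookup e) (sVars i) ys (aVars i)) (trans
            (cong₂ _[ ys ↦*_] (fill-sVars (nonempty 𝒜) s a i) (fill-aVars (nonempty 𝒜) s a i))
            (sym (proj₂ (proj₂ (proj₂ (pre i))))))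
          conclude : SatFO (expand 𝒜 T) e body → 𝒜 ⊨[ S ] β
          conclude (inj₁ ¬premise) = contradiction
            (from (⋀-sat _ (allFin k)) (All.tabulate {xs = allFin k} λ {i} _ →
              subst T (sym (fill-sVars (nonempty 𝒜) s a i)) (proj₁ (proj₂ (proj₂ (pre i)))))) ¬premise
          conclude (inj₂ h′) = teamFormula-sound 𝒜 e q (List.tabulate tuple) h′ λ {t} t∈S →
            let i , fi≡t = covers t∈S in
            tuple i , ∈-tabulate⁺ i , trans (sym fi≡t) (sym (values i))

  coherent⇒universallyRewritable : (ys : n ▷* m) {β : ∀𝒟 τ m} → QuantifierFree β →
    StronglyCoherent ys β → UniversallyRewritable (all* ys β)
  coherent⇒universallyRewritable ys q (k , _ , coherent) =
    sentence , sentence-universal , λ 𝒜 T → sentence-sat 𝒜 T ⇔-∘ coherent 𝒜 T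
    where open CoherenceSentence k ys q

-- Numberings of pairs, tuples and tasks

nextPair : ℕ × ℕ → ℕ × ℕ
nextPair (zero  , b) = suc b , zero
nextPair (suc a , b) = a , suc b

-- An inverse of Cantor's pairing function: each antidiagonal `a + b = d` is traversed from
-- `(d , 0)` to `(0 , d)`.
unpair : ℕ → ℕ × ℕ
unpair zero    = zero , zero
unpair (suc x) = nextPair (unpair x)

-- The traversal is run backwards: along the antidiagonal while the second component is positive,
-- then to the end of the preceding antidiagonal.
unpair-surjective : ∀ a b → ∃ λ x → unpair x ≡ (a , b)
unpair-surjective a b = onDiagonal (a + b) a b refl
  where
  onDiagonal : ∀ d a b → a + b ≡ d → ∃ λ x → unpair x ≡ (a , b)
  onDiagonal d a (suc b) a+b≡d
    with onDiagonal d (suc a) b (trans (sym (+-suc a b)) a+b≡d)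
  ... | x , x↦ = suc x , cong nextPair x↦
  onDiagonal zero    zero    zero _ = zero , refl
  onDiagonal (suc d) (suc a) zero a+0≡d
    with onDiagonal d zero a (trans (sym (+-identityʳ a)) (suc-injective a+0≡d))
  ... | x , x↦ = suc x , cong nextPair x↦

-- Ensures that the indices occurring in task `x` are at most `x`, as a construction in stages
-- requires.
unpair-≤ : ∀ x → proj₁ (unpair x) + proj₂ (unpair x) ≤ x
unpair-≤ zero    = z≤n
unpair-≤ (suc x) with unpair x | unpair-≤ x
... | zero  , b | b≤x = s≤s (≤-trans (≤-reflexive (+-identityʳ b)) b≤x)
... | suc a , b | a+b≤x = ≤-trans (≤-reflexive (+-suc a b)) (≤-trans a+b≤x (n≤1+n x))

unpair₁-≤ : ∀ x → proj₁ (unpair x) ≤ x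
unpair₁-≤ x = ≤-trans (m≤m+n _ _) (unpair-≤ x)

unpair₂-≤ : ∀ x → proj₂ (unpair x) ≤ x
unpair₂-≤ x = ≤-trans (m≤n+m _ _) (unpair-≤ x)

decode : ∀ m → ℕ → Vec ℕ m
decode zero    _ = []
decode (suc m) x = proj₁ (unpair x) ∷ decode m (proj₂ (unpair x))

decode-surjective : (v : Vec ℕ m) → ∃ λ x → decode m x ≡ v
decode-surjective []      = zero , refl
decode-surjective (a ∷ v) with decode-surjective v
... | y , refl with unpair-surjective a y
... | x , x↦ = x , cong (λ p → proj₁ p ∷ decode _ (proj₂ p)) x↦

decode-≤ : ∀ m x → VecAll.All (_≤ x) (decode m x)
decode-≤ zero    x = []
decode-≤ (suc m) x =
  unpair₁-≤ x ∷ VecAll.map (λ i≤ → ≤-trans i≤ (unpair₂-≤ x)) (decode-≤ m (proj₂ (unpair x)))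

-- A task is a property from a finite list together with a tuple of indices. `default` is used
-- beyond the end of the list, so that every number codes a task.
module Tasks {ℓ} {P : ℕ → Set ℓ} (default : ∃ P) where

  nth : List (∃ P) → ℕ → ∃ P
  nth []       _       = default
  nth (d ∷ ds) zero    = d
  nth (d ∷ ds) (suc i) = nth ds i

  nth-surjective : ∀ {d ds} → d ∈ˡ ds → ∃ λ i → nth ds i ≡ d
  nth-surjective (here refl) = zero , refl
  nth-surjective (there d∈)  = let i , i↦ = nth-surjective d∈ in suc i , i↦

  task : List (∃ P) → ℕ → ∃ λ m → P m × Vec ℕ m
  task ds x =
    let i , y = unpair x
        m , d = nth ds i
    in m , d , decode m y

  task-≤ : ∀ ds x → VecAll.All (_≤ x) (proj₂ (proj₂ (task ds x)))
  task-≤ ds x = VecAll.map (λ i≤ → ≤-trans i≤ (unpair₂-≤ x)) (decode-≤ _ (proj₂ (unpair x)))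

  task-surjective : ∀ {m d ds} → (m , d) ∈ˡ ds → (v : Vec ℕ m) → ∃ λ x → task ds x ≡ (m , d , v)
  task-surjective {m} {d} {ds} d∈ v with nth-surjective d∈ | decode-surjective v
  ... | i , i↦ | y , y↦ with unpair-surjective i y
  ...   | x , x↦ = x , trans
    (cong (λ p → let e = nth ds (proj₁ p) in proj₁ e , proj₂ e , decode (proj₁ e) (proj₂ p)) x↦) (trans
    (cong (λ e → proj₁ e , proj₂ e , decode (proj₁ e) y) i↦)
    (cong (λ w → m , d , w) y↦))

-- A filter on ℕ that decides countably many sets

record Filter (Q : ℕ → Pred ℕ 0ℓ) : Set₁ where
  field
    Eventually : Pred ℕ 0ℓ → Set
    mono       : ∀ {P P′} → P ⊆ P′ → Eventually P → Eventually P′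
    both       : ∀ {P P′} → Eventually P → Eventually P′ → Eventually (P ∩ P′)
    tail       : ∀ N → Eventually (N ≤_)
    proper     : ∀ {P} → Eventually P → ¬ (∀ k → ¬ P k)
    decides    : ∀ x → Eventually (Q x) ⊎ Eventually (∁ (Q x))

  always : ∀ {P} → (∀ k → P k) → Eventually P
  always h = mono (λ {k} _ → h k) (tail 0)

  every : ∀ {n} {P : Fin n → Pred ℕ 0ℓ} → (∀ i → Eventually (P i)) → Eventually (λ k → ∀ i → P i k)
  every {zero}  h = always λ _ ()
  every {suc n} h = mono (λ (p , ps) → λ { zero → p ; (suc i) → ps i }) (both (h zero) (every (h ∘ suc)))

module _ (em : ExcludedMiddle 0ℓ) where

  Infinite : Pred ℕ 0ℓ → Set
  Infinite Y = ∀ N → ∃ λ k → N ≤ k × k ∈ Y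

  -- An infinite set is not the union of two bounded sets.
  refine : (Z Q : Pred ℕ 0ℓ) → Infinite Z → ∃ λ Y → Infinite Y × Y ⊆ Z × (Y ⊆ Q ⊎ Y ⊆ ∁ Q)
  refine Z Q inf with em {Infinite (Z ∩ Q)}
  ... | yes inf′ = Z ∩ Q , inf′ , proj₁ , inj₁ proj₂
  ... | no  fin  = Z ∩ ∁ Q , inf′ , proj₁ , inj₂ proj₂
    where
    inf′ : Infinite (Z ∩ ∁ Q)
    -- If `Z` had no element outside `Q` from `N` on, its elements above `N ⊔ N′` would make `Z ∩ Q`
    -- infinite.
    inf′ N = decidable-stable em λ none → fin λ N′ →
      let k , N⊔N′≤k , k∈Z = inf (N ⊔ N′) in
      k , ≤-trans (m≤n⊔m N N′) N⊔N′≤k , k∈Z ,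
      decidable-stable em λ k∉Q → none (k , ≤-trans (m≤m⊔n N N′) N⊔N′≤k , k∈Z , k∉Q)

  -- Generated by the cofinite sets and a descending chain of infinite sets,
  -- the (x + 1)-st of which decides Q x.
  decidingFilter : (Q : ℕ → Pred ℕ 0ℓ) → Filter Q
  decidingFilter Q = record
    { Eventually = λ P → ∃ λ x → ∀ {k} → x ≤ k → k ∈ member x → P k
    ; mono       = λ P⊆P′ (x , h) → x , λ x≤k k∈ → P⊆P′ (h x≤k k∈)
    ; both       = λ (x , h) (x′ , h′) → x ⊔ x′ , λ x⊔x′≤k k∈ →
        h  (≤-trans (m≤m⊔n x x′) x⊔x′≤k) (antitone (m≤m⊔n x x′) k∈) ,
        h′ (≤-trans (m≤n⊔m x x′) x⊔x′≤k) (antitone (m≤n⊔m x x′) k∈)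
    ; tail       = λ N → N , λ N≤k _ → N≤k
    ; proper     = λ (x , h) none → let k , x≤k , k∈ = proj₂ (chain x) x in none k (h x≤k k∈)
    ; decides    = λ x → Sum.map (λ ⊆Q → suc x , λ _ k∈ → ⊆Q k∈) (λ ⊆∁Q → suc x , λ _ k∈ → ⊆∁Q k∈)
        (proj₂ (proj₂ (proj₂ (refine (member x) (Q x) (proj₂ (chain x))))))
    }
    where
    chain : ℕ → ∃ Infinite
    chain zero    = (λ _ → ⊤) , λ N → N , ≤-refl , tt
    chain (suc x) = let Y , inf , _ = refine (proj₁ (chain x)) (Q x) (proj₂ (chain x)) in Y , inf
    member : ℕ → Pred ℕ 0ℓ
    member x = proj₁ (chain x)
    antitone : ∀ {x x′} → x ≤ x′ → member x′ ⊆ member x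
    antitone x≤x′ = antitone′ (≤⇒≤′ x≤x′)
      where
      antitone′ : ∀ {x x′} → x ≤′ x′ → member x′ ⊆ member x
      antitone′ (≤′-reflexive refl) k∈ = k∈
      antitone′ {x′ = suc x′} (≤′-step x≤x′) k∈ =
        antitone′ x≤x′ (proj₁ (proj₂ (proj₂ (refine (member x′) (Q x′) (proj₂ (chain x′))))) k∈)

  least : {P : Pred ℕ 0ℓ} → ∃ P → ∃ λ i → P i × (∀ {j} → P j → i ≤ j)
  least {P} (i , p) = <-rec (λ i → P i → ∃ λ i → P i × (∀ {j} → P j → i ≤ j)) step i p
    where
    step : ∀ i → (∀ {j} → j < i → P j → ∃ λ i → P i × (∀ {j} → P j → i ≤ j)) →
           P i → ∃ λ i → P i × (∀ {j} → P j → i ≤ j)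
    step i rec p with em {∃ λ j → j < i × P j}
    ... | yes (j , j<i , pj) = rec j<i pj
    ... | no  none           = i , p , λ {j} pj → ≮⇒≥ λ j<i → none (j , j<i , pj)

  -- Countable sets of sequences: closure under witnesses, and the sets to be decided

  module Sequences (A : ℕ → Set) where

    Property : ℕ → Set₁
    Property m = ∀ k → Pred (Vec (A k) m) 0ℓ

    values : (ℕ → ∀ k → A k) → ∀ k → Vec ℕ m → Vec (A k) m
    values c k = map (λ i → c i k)

    -- The sequence `c i` is the value of a Skolem function at `v`, in all coordinates at once; a
    -- coordinate without a witness imposes nothing.
    Witnessed : (ℕ → ∀ k → A k) → ∃ (Property ∘ suc) → Set
    Witnessed c (m , d) = (v : Vec ℕ m) →
      ∃ λ i → ∀ k → (∃ λ a → d k (a ∷ values c k v)) → d k (c i k ∷ values c k v)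

    Decided : (ℕ → ∀ k → A k) → (Pred ℕ 0ℓ → Set) → ∃ Property → Set
    Decided c Eventually (m , d) = (v : Vec ℕ m) →
      Eventually (λ k → d k (values c k v)) ⊎ Eventually (λ k → ¬ d k (values c k v))

    -- Sequence `x + 1` is built to answer task `x`, whose parameters have indices at most `x` and
    -- therefore exist already.
    module Skolem (base : ∀ k → A k) (ds : List (∃ (Property ∘ suc))) where

      open Tasks {P = Property ∘ suc} (0 , λ _ _ → ⊤)

      witness : (P : X → Set) → X → ∃ λ x → ∃ P → P x
      witness P x₀ with em {∃ P}
      ... | yes (x , p) = x , λ _ → p
      ... | no  none    = x₀ , λ some → contradiction some none

      Answers : ℕ → (ℕ → ∀ k → A k) → (∀ k → A k) → Set
      Answers x c a = let m , d , v = task ds x in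
        ∀ k → (∃ λ b → d k (b ∷ values c k v)) → d k (a k ∷ values c k v)

      answer : ∀ x c → ∃ (Answers x c)
      answer x c = let m , d , v = task ds x in
        (λ k → proj₁ (witness (λ b → d k (b ∷ values c k v)) (base k))) ,
        (λ k → proj₂ (witness (λ b → d k (b ∷ values c k v)) (base k)))

      -- stage x is meaningful at arguments ≤ x.
      stage : ℕ → ℕ → ∀ k → A k
      stage zero    _ = base
      stage (suc x) j with j ≤? x
      ... | yes _ = stage x j
      ... | no  _ = proj₁ (answer x (stage x))

      sequence : ℕ → ∀ k → A k
      sequence x = stage x x

      stage-stable : ∀ {x j} → j ≤ x → stage x j ≡ sequence j
      stage-stable {zero}  z≤n = refl
      stage-stable {suc x} {j} j≤ with j ≤? x in eq
      ... | yes j≤x = stage-stable j≤x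
      -- Here `j` is `suc x`, and both sides are the newly added sequence.
      ... | no  j≰x with ≤-antisym j≤ (≰⇒> j≰x)
      ...   | refl rewrite eq = refl

      sequence-suc : ∀ x → sequence (suc x) ≡ proj₁ (answer x (stage x))
      sequence-suc x with suc x ≤? x
      ... | yes 1+x≤x = contradiction 1+x≤x (n≮n x)
      ... | no  _     = refl

      values-stage : ∀ {x} k {v : Vec ℕ m} → VecAll.All (_≤ x) v → values (stage x) k v ≡ values sequence k v
      values-stage k []         = refl
      values-stage k (i≤x ∷ v≤) = cong₂ _∷_ (cong (λ f → f k) (stage-stable i≤x)) (values-stage k v≤)

      -- The answer was computed from `stage x`, and later stages leave the parameters of task `x`
      -- unchanged.
      answered : ∀ x → Answers x sequence (sequence (suc x))
      answered x k = subst₂ (λ w a → (∃ λ b → d k (b ∷ w)) → d k (a k ∷ w))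
        (values-stage k (task-≤ ds x)) (sym (sequence-suc x)) (proj₂ (answer x (stage x)) k)
        where d = proj₁ (proj₂ (task ds x))

      witnessed : All (Witnessed sequence) ds
      witnessed = All.tabulate λ {(m , d)} d∈ v →
        let x , x↦ = task-surjective d∈ v in
        suc x , subst (λ (m , d , v) → ∀ k → (∃ λ b → d k (b ∷ values sequence k v)) →
                                      d k (sequence (suc x) k ∷ values sequence k v)) x↦ (answered x)

    -- Each property yields one set of coordinates per tuple of indices, hence countably many sets
    -- in all, which serve as the sets that a filter must decide.
    module Decisions (c : ℕ → ∀ k → A k) (ds : List (∃ Property)) where

      open Tasks {P = Property} (0 , λ _ _ → ⊤)

      question : ℕ → Pred ℕ 0ℓ
      question x k = let m , d , v = task ds x in d k (values c k v)

      decided : (F : Filter question) → All (Decided c (Filter.Eventually F)) ds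
      decided F = All.tabulate λ {(m , d)} d∈ v →
        let x , x↦ = task-surjective d∈ v in
        subst (λ (m , d , v) → Eventually (λ k → d k (values c k v)) ⊎ Eventually (λ k → ¬ d k (values c k v)))
          x↦ (decides x)
        where open Filter F

  module Families (𝒜 : ℕ → Structure τ) where

    open Sequences (λ k → Carrier (𝒜 k)) public

    module _ (T : ∀ k → Team (Carrier (𝒜 k)) n) where

      ℬ : ∀ k → Structure (τ ∪[ n ])
      ℬ k = expand (𝒜 k) (T k)

      sat : FO (τ ∪[ n ]) m → Property m
      sat χ k s = SatFO (ℬ k) s χ

      -- Any filter commutes with conjunction, and witnesses handle the quantifiers; only negation
      -- and disjunction call for a decision.
      decisions : FO (τ ∪[ n ]) m → List (∃ Property)
      decisions (atom _ _) = []
      decisions (eq _ _)   = []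
      decisions (not χ)    = (_ , sat χ) ∷ decisions χ
      decisions (χ ∧ ξ)    = decisions χ List.++ decisions ξ
      decisions (χ ∨ ξ)    = (_ , sat χ) ∷ decisions χ List.++ decisions ξ
      decisions (all χ)    = decisions χ
      decisions (ex χ)     = decisions χ

      -- For a universal quantifier the required witness is a counterexample.
      choices : FO (τ ∪[ n ]) m → List (∃ (Property ∘ suc))
      choices (atom _ _) = []
      choices (eq _ _)   = []
      choices (not χ)    = choices χ
      choices (χ ∧ ξ)    = choices χ List.++ choices ξ
      choices (χ ∨ ξ)    = choices χ List.++ choices ξ
      choices (all χ)    = (_ , sat (not χ)) ∷ choices χ
      choices (ex χ)     = (_ , sat χ) ∷ choices χ

    -- Only the first team of each splitting is recorded: an assignment of the split team that is
    -- eventually outside it is eventually in the second.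
    splits : {β : ∀𝒟 τ m} → QuantifierFree β → (W : ∀ k → Team (Carrier (𝒜 k)) m) →
             (∀ k → 𝒜 k ⊨[ W k ] β) → List (∃ Property)
    splits (lit _)     W h = []
    splits (dep _ _ _) W h = []
    splits (p ∧ q)     W h = splits p W (proj₁ ∘ h) List.++ splits q W (proj₂ ∘ h)
    splits (p ∨ q)     W h =
      (_ , (λ k → proj₁ (h k))) ∷
      splits p _ (λ k → proj₁ (proj₂ (proj₂ (proj₂ (h k))))) List.++
      splits q _ (λ k → proj₂ (proj₂ (proj₂ (proj₂ (h k)))))

  -- The limit structure

  module Limit (𝒜 : ℕ → Structure τ) (c : ℕ → ∀ k → Carrier (𝒜 k)) {Q : ℕ → Pred ℕ 0ℓ} (F : Filter Q) where

    open Filter F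
    open Families 𝒜

    _≈_ : ℕ → ℕ → Set
    i ≈ j = Eventually λ k → c i k ≡ c j k

    ≈-sym : ∀ {i j} → i ≈ j → j ≈ i
    ≈-sym = mono sym

    ≈-trans : ∀ {i j h} → i ≈ j → j ≈ h → i ≈ h
    ≈-trans i≈j j≈h = mono (λ (p , q) → trans p q) (both i≈j j≈h)

    rep : ℕ → ℕ
    rep i = proj₁ (least {λ j → i ≈ j} (i , always λ _ → refl))

    ≈-rep : ∀ i → i ≈ rep i
    ≈-rep i = proj₁ (proj₂ (least {λ j → i ≈ j} (i , always λ _ → refl)))

    rep-≤ : ∀ {i j} → i ≈ j → rep i ≤ j
    rep-≤ {i} = proj₂ (proj₂ (least {λ j → i ≈ j} (i , always λ _ → refl)))

    rep-cong : ∀ {i j} → i ≈ j → rep i ≡ rep j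
    rep-cong {i} {j} i≈j =
      ≤-antisym (rep-≤ (≈-trans i≈j (≈-rep j))) (rep-≤ (≈-trans (≈-sym i≈j) (≈-rep i)))

    -- Equality of elements of the structure has to be _≡_, so the quotient of
    -- ℕ by _≈_ is formed by least representatives.
    Element : Set
    Element = ∃ λ i → rep i ≡ i

    [_] : ℕ → Element
    [ i ] = rep i , rep-cong (≈-sym (≈-rep i))

    separated : {x y : Element} → proj₁ x ≈ proj₁ y → x ≡ y
    separated {i , i-rep} {j , j-rep} i≈j with trans (sym i-rep) (trans (rep-cong i≈j) j-rep)
    ... | refl = cong (i ,_) (≡-irrelevant i-rep j-rep)

    at : ∀ k → Vec Element m → Vec (Carrier (𝒜 k)) m
    at k = map (λ x → c (proj₁ x) k)

    at≡values : ∀ k (s : Vec Element m) → at k s ≡ values c k (map proj₁ s)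
    at≡values k s = map-∘ (λ i → c i k) proj₁ s

    limit : Structure τ
    limit = record
      { Carrier  = Element
      ; nonempty = [ 0 ]
      ; rel      = λ R s → Eventually λ k → at k s ∈ rel (𝒜 k) R
      }

    limitTeam : (∀ k → Team (Carrier (𝒜 k)) m) → Team Element m
    limitTeam W s = Eventually λ k → at k s ∈ W k

    lookup-at : ∀ {k} (s : Vec Element m) x → lookup (at k s) x ≡ c (proj₁ (lookup s x)) k
    lookup-at {k = k} s x = lookup-map x (λ y → c (proj₁ y) k) s

    lookup-≡ : (s t : Vec Element m) (x y : Fin m) →
               (lookup s x ≡ lookup t y) ⇔ Eventually (λ k → lookup (at k s) x ≡ lookup (at k t) y)
    lookup-≡ s t x y = mk⇔
      (λ eq → always λ k → trans (lookup-at s x) (trans (cong (λ z → c (proj₁ z) k) eq) (sym (lookup-at t y))))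
      (λ ev → separated (mono (λ eq → trans (sym (lookup-at s x)) (trans eq (lookup-at t y))) ev))

    decided-at : (d : Property m) → Decided c Eventually (m , d) → (s : Vec Element m) →
                 Eventually (λ k → d k (at k s)) ⊎ Eventually (λ k → ¬ d k (at k s))
    decided-at d dec s = Sum.map
      (mono λ {k} → subst (d k) (sym (at≡values k s)))
      (mono λ {k} → subst (¬_ ∘ d k) (sym (at≡values k s)))
      (dec (map proj₁ s))

    witnessed-at : (d : Property (suc m)) → Witnessed c (m , d) → (s : Vec Element m) →
                   ∃ λ x → Eventually (λ k → (∃ λ a → d k (a ∷ at k s)) → d k (at k (x ∷ s)))
    witnessed-at d wit s = let i , h = wit (map proj₁ s) in
      -- `[ i ]` is given by a least representative, which agrees with sequence `i` only eventually;
      -- this is why the conclusion is an `Eventually`.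
      [ i ] , mono (λ {k} ci≡ (a , p) → subst₂ (λ b w → d k (b ∷ w)) ci≡ (sym (at≡values k s))
                (h k (a , subst (λ w → d k (a ∷ w)) (at≡values k s) p)))
              (≈-rep i)

    module _ (T : ∀ k → Team (Carrier (𝒜 k)) n) where

      rel-limit : (R : Sym (τ ∪[ n ])) (s : Vec Element (arity (τ ∪[ n ]) R)) →
                  rel (expand limit (limitTeam T)) R s ≡ Eventually (λ k → at k s ∈ rel (ℬ T k) R)
      rel-limit (just _) s = refl
      rel-limit nothing  s = refl

      -- Induction on `χ`. Decisions for its negated and disjunctive subformulas replace an
      -- ultrafilter, and closure of `c` under witnesses replaces the full product.
      łoś : (χ : FO (τ ∪[ n ]) m) → All (Decided c Eventually) (decisions T χ) → All (Witnessed c) (choices T χ) →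
            (s : Vec Element m) → SatFO (expand limit (limitTeam T)) s χ ⇔ Eventually (λ k → SatFO (ℬ T k) (at k s) χ)
      łoś (atom R xs) _ _ s rewrite rel-limit R (map (lookup s) xs) = mk⇔
        (mono λ {k} → subst (rel (ℬ T k) R) (sym (map-lookup-map _ s xs)))
        (mono λ {k} → subst (rel (ℬ T k) R) (map-lookup-map _ s xs))
      łoś (eq x y) _ _ s = lookup-≡ s s x y
      łoś (not χ) (dec ∷ decs) wits s = mk⇔
        (λ ¬χ → [ (λ ev → contradiction (from (łoś χ decs wits s) ev) ¬χ) , id ]′ (decided-at (sat T χ) dec s))
        (λ ev χ-holds → proper (both ev (to (łoś χ decs wits s) χ-holds)) λ _ (¬p , p) → ¬p p)
      łoś (χ ∧ ξ) decs wits s = mk⇔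
        (λ (p , q) → both (to łoś₁ p) (to łoś₂ q))
        (λ ev → from łoś₁ (mono proj₁ ev) , from łoś₂ (mono proj₂ ev))
        where
        łoś₁ = łoś χ (All.++⁻ˡ (decisions T χ) decs) (All.++⁻ˡ (choices T χ) wits) s
        łoś₂ = łoś ξ (All.++⁻ʳ (decisions T χ) decs) (All.++⁻ʳ (choices T χ) wits) s
      łoś (χ ∨ ξ) (dec ∷ decs) wits s = mk⇔
        [ mono inj₁ ∘ to łoś₁ , mono inj₂ ∘ to łoś₂ ]′
        (λ ev → Sum.map (from łoś₁)
          (λ ¬χ → from łoś₂ (mono (λ { (inj₁ p , ¬p) → contradiction p ¬p ; (inj₂ q , _) → q }) (both ev ¬χ)))
          (decided-at (sat T χ) dec s))
        where
        łoś₁ = łoś χ (All.++⁻ˡ (decisions T χ) decs) (All.++⁻ˡ (choices T χ) wits) s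
        łoś₂ = łoś ξ (All.++⁻ʳ (decisions T χ) decs) (All.++⁻ʳ (choices T χ) wits) s
      łoś (all χ) decs (wit ∷ wits) s = mk⇔
        -- `x` is a counterexample in almost every coordinate that has one, so if `χ` holds at `x`
        -- there, no counterexample exists.
        (λ h → let x , counterexample = witnessed-at (sat T (not χ)) wit s in
          mono (λ (p , q) a → decidable-stable em λ ¬p → q (a , ¬p) p)
               (both (to (łoś χ decs wits (x ∷ s)) (h x)) counterexample))
        (λ ev x → from (łoś χ decs wits (x ∷ s)) (mono (λ h → h _) ev))
      łoś (ex χ) decs (wit ∷ wits) s = mk⇔
        (λ (x , h) → mono (_ ,_) (to (łoś χ decs wits (x ∷ s)) h))
        (λ ev → let x , example = witnessed-at (sat T χ) wit s in
          x , from (łoś χ decs wits (x ∷ s)) (mono (λ (p , q) → q p) (both ev example)))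

    -- Only this direction is needed, so negative literals require just properness. A dependence
    -- atom has finitely many premises, which eventually hold together; at a disjunction, the limits
    -- of the two parts split the limit team.
    limitTeam-⊨ : {β : ∀𝒟 τ m} (q : QuantifierFree β) (W : ∀ k → Team (Carrier (𝒜 k)) m)
                  (h : ∀ k → 𝒜 k ⊨[ W k ] β) → All (Decided c Eventually) (splits q W h) → limit ⊨[ limitTeam W ] β
    limitTeam-⊨ (lit l) W h _ = lift λ {s} s∈W → literal l s (mono (λ {k} → lower (h k)) s∈W)
      where
      literal : (l : Literal τ m) (s : Vec Element m) →
                Eventually (λ k → SatLiteral (𝒜 k) (at k s) l) → SatLiteral limit s l
      literal (pos R xs) s = mono λ {k} → subst (rel (𝒜 k) R) (map-lookup-map _ s xs)
      literal (neg R xs) s ev ev′ = proper (both ev ev′) λ k (¬p , p) →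
        ¬p (subst (rel (𝒜 k) R) (sym (map-lookup-map _ s xs)) p)
      literal (eq x y)   s = from (lookup-≡ s s x y)
      literal (neq x y)  s ev s≡ = proper (both ev (to (lookup-≡ s s x y) s≡)) λ _ (¬p , p) → ¬p p
    limitTeam-⊨ (dep ys z _) W h _ = lift λ {s} {t} s∈W t∈W agree →
      from (lookup-≡ s t z z)
        (mono (λ {k} ((p , q) , r) → lower (h k) p q r)
          (both (both s∈W t∈W) (every λ j → to (lookup-≡ s t (lookup ys j) (lookup ys j)) (agree j))))
    limitTeam-⊨ (p ∧ q) W h decs =
      limitTeam-⊨ p W (proj₁ ∘ h) (All.++⁻ˡ (splits p W (proj₁ ∘ h)) decs) ,
      limitTeam-⊨ q W (proj₂ ∘ h) (All.++⁻ʳ (splits p W (proj₁ ∘ h)) decs)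
    limitTeam-⊨ (p ∨ q) W h (dec ∷ decs) =
      limitTeam W₁ , limitTeam W₂ ,
      -- The filter decides whether `s` lies in `W₁`; if eventually not, then `s` eventually lies in
      -- `W₂`.
      ((λ {s} s∈W → Sum.map id
         (λ s∉W₁ → mono (λ {k} (s∈ , s∉) → [ (λ s∈W₁ → contradiction s∈W₁ s∉) , id ]′ (proj₁ (W≐ k) s∈))
                        (both s∈W s∉W₁))
         (decided-at W₁ dec s)) ,
       [ mono (λ {k} → proj₂ (W≐ k) ∘ inj₁) , mono (λ {k} → proj₂ (W≐ k) ∘ inj₂) ]′) ,
      limitTeam-⊨ p W₁ h₁ (All.++⁻ˡ (splits p W₁ h₁) decs) ,
      limitTeam-⊨ q W₂ h₂ (All.++⁻ʳ (splits p W₁ h₁) decs)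
      where
      W₁ : ∀ k → Team (Carrier (𝒜 k)) _
      W₁ k = proj₁ (h k)
      W₂ : ∀ k → Team (Carrier (𝒜 k)) _
      W₂ k = proj₁ (proj₂ (h k))
      W≐ : ∀ k → W k ≐ W₁ k ∪ W₂ k
      W≐ k = proj₁ (proj₂ (proj₂ (h k)))
      h₁ = λ k → proj₁ (proj₂ (proj₂ (proj₂ (h k))))
      h₂ = λ k → proj₂ (proj₂ (proj₂ (proj₂ (h k))))

  -- From first-order rewritability to strong coherence

  module Compactness (ys : n ▷* m) {β : ∀𝒟 τ m} (q : QuantifierFree β)
    (𝒜 : ℕ → Structure τ) (T : ∀ k → Team (Carrier (𝒜 k)) n)
    (bounded : ∀ k → Bounded (suc k) ys β (𝒜 k) (T k)) (χ : Sentence (τ ∪[ n ])) where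

    open Families 𝒜

    open Skolem (λ k → nonempty (𝒜 k)) (choices T χ) renaming (sequence to c; witnessed to c-witnessed)

    -- The limit of these finite teams contains the limit of the teams T k ⟨ ys ⟩*,
    -- because each tuple of the limit structure has a number j ≤ k for all large k.
    S : ∀ k → Team (Carrier (𝒜 k)) m
    S k t = t ∈ T k ⟨ ys ⟩* × t ∈ˡ List.map (λ j → values c k (decode m j)) (upTo (suc k))

    -- The indices `0` to `k` give at most `k + 1` tuples, which is exactly the bound in `bounded`.
    S-⊨ : ∀ k → 𝒜 k ⊨[ S k ] β
    S-⊨ k = bounded k (S k) proj₁
      (_ , ≤-reflexive (trans (length-map _ (upTo (suc k))) (length-upTo (suc k))) , proj₂)

    -- The sets to be decided involve the splittings of `S k`, which depend on `c`; so the sequences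
    -- are fixed before the filter.
    open Decisions c (decisions T χ List.++ splits q S S-⊨) using (question; decided)

    module _ (filter : Filter question) where

      open Filter filter
      open Limit 𝒜 c filter

      ⟨ys⟩⊆S : (limitTeam T) ⟨ ys ⟩* ⊆ limitTeam S
      ⟨ys⟩⊆S {t} t∈ with ∈-⟨⟩*⁻ ys t∈ | decode-surjective (map proj₁ t)
      ... | s , as , s∈ , refl | j , j↦ = mono in-S (both s∈ (tail j))
        where
        in-S : ∀ {k} → at k s ∈ T k × j ≤ k → at k t ∈ S k
        in-S {k} (s∈T , j≤k) =
          subst (_∈ T k ⟨ ys ⟩*) (sym (map-↦* _ s ys as)) (∈-⟨⟩*⁺ ys (at k as) s∈T) ,
          subst (_∈ˡ _) (trans (cong (values c k) j↦) (sym (at≡values k t))) (∈-map⁺ _ (∈-upTo⁺ (s≤s j≤k)))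

      limit-⊨ : limit ⊨[ limitTeam T ] all* ys β
      limit-⊨ = subst id (sym (⊨-all* limit ys)) (downward-closed q limit ⟨ys⟩⊆S
        (limitTeam-⊨ q S S-⊨ (All.++⁻ʳ (decisions T χ) (decided filter))))

      limit-sat : expand limit (limitTeam T) ⊨ χ ⇔ Eventually (λ k → expand (𝒜 k) (T k) ⊨ χ)
      limit-sat = łoś T χ (All.++⁻ˡ (decisions T χ) (decided filter)) c-witnessed []

      -- The limit team satisfies the formula, so `χ` is true in the limit and hence in some
      -- coordinate.
      some-⊨ : χ Rewrites all* ys β → ¬ (∀ k → ¬ 𝒜 k ⊨[ T k ] all* ys β)
      some-⊨ rewrites unsat = proper (to limit-sat (to (rewrites limit (limitTeam T)) limit-⊨))
        λ k χ-holds → unsat k (from (rewrites (𝒜 k) (T k)) χ-holds)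

rewritable⇒coherent : ExcludedMiddle (lsuc 0ℓ) → (ys : n ▷* m) {β : ∀𝒟 τ m} → QuantifierFree β →
  FORewritable (all* ys β) → StronglyCoherent ys β
rewritable⇒coherent {n = n} {τ = τ} em ys {β} q (χ , rewrites) = decidable-stable em λ incoherent →
  let counterexample : ∀ k → Counterexample k
      -- The bound `suc k` is positive, as strong coherence demands.
      counterexample k = decidable-stable em λ none → incoherent (suc k , s≤s z≤n , coherent k none)
      open Compactness em₀ ys q (λ k → proj₁ (counterexample k)) (λ k → proj₁ (proj₂ (counterexample k)))
        (λ k → proj₁ (proj₂ (proj₂ (counterexample k)))) χ
  in some-⊨ (decidingFilter em₀ _) rewrites (λ k → proj₂ (proj₂ (proj₂ (counterexample k))))
  where
  em₀ : ExcludedMiddle 0ℓ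
  em₀ = excluded-middle₀ em
  Counterexample : ℕ → Set₁
  Counterexample k = ∃ λ 𝒜 → ∃ λ T → Bounded (suc k) ys β 𝒜 T × ¬ 𝒜 ⊨[ T ] all* ys β
  coherent : ∀ k → ¬ Counterexample k → StronglyCoherentWith (suc k) ys β
  coherent k none 𝒜 T = mk⇔
    -- This half is downward closure and holds for subteams of any size.
    (λ h S S⊆ _ → downward-closed q 𝒜 (λ s∈S → S⊆ s∈S) (subst id (⊨-all* 𝒜 ys) h))
    (λ bounded → decidable-stable em λ unsat → none (𝒜 , T , bounded , unsat))

theorem21 : ExcludedMiddle (lsuc 0ℓ) →
    (τ : Vocabulary) (n m : ℕ) (ys : n ▷* m) (β : ∀𝒟 τ m) → QuantifierFree β →
    (StronglyCoherent ys β ⇔ UniversallyRewritable (all* ys β)) ×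
    (UniversallyRewritable (all* ys β) ⇔ FORewritable (all* ys β))
theorem21 em τ n m ys β q =
  mk⇔ 1⇒2 (3⇒1 ∘ 2⇒3) , mk⇔ 2⇒3 (1⇒2 ∘ 3⇒1)
  where
  1⇒2 = coherent⇒universallyRewritable (excluded-middle₀ em) ys q
  2⇒3 : UniversallyRewritable (all* ys β) → FORewritable (all* ys β)
  2⇒3 (χ , _ , rewrites) = χ , rewrites
  3⇒1 = rewritable⇒coherent em ys q
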